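{- Let $p$ be an odd prime, $1\le m\le n$, and let $I$ be the generalized order ideal of $\mathbb{GH}(m,n)$, of saturated or unsaturated type, in which every element of $[n]$ has multiplicity $p-1$ (i.e. all multiplicities lie in $\{0,p-1\}$ and the support of $I$ is $[n]$). Let $f:\mathbb{F}_p^n\to\mathbb{F}_p$ be the characteristic function of $I(\mathbb{GP})\setminus\{0\}$ and \[ \mathcal{C}_f=\{(sf(x)+u\cdot x)_{x\in\mathbb{F}_p^n\setminus0}:\ s\in\mathbb{F}_p,\ u\in\mathbb{F}_p^n\}. \] If $m=1$, then $\mathcal{C}_f$ is not minimal for either notion (saturated or unsaturated). If $m=n-1\ge2$ and the notion is saturated, then $\mathcal{C}_f$ is not minimal.
   Context: $[n]=\{1,\dots,n\}$; $u\cdot x=\sum_i u_ix_i$. A nonzero codeword $c$ of a linear code $\mathcal{C}$ over $\mathbb{F}_p$ is minimal if $c'\in\mathcal{C}$ and $\mathrm{supp}(c')\subseteq\mathrm{supp}(c)$ imply $c'\in\mathbb{F}_pc$; $\mathcal{C}$ is minimal if all its nonzero codewords are. Generalized order ideals: $[n]_{p-1}$ is the multiset in which each $i\in[n]$ has multiplicity $p-1$. A sub-multiset $J$ is identified with its multiplicity vector $(J_1,\dots,J_n)\in\{0,\dots,p-1\}^n=\mathbb{F}_p^n$; $J\subseteq J'$ means $J_i\le J'_i$ (as integers) for all $i$; $\bar J=\{i:J_i\ne0\}$. The hierarchical poset $\mathbb{H}(m,n)$ on $[n]$ has as its only strict relations $i\prec j$ for all $i\in[m]$, $j\in[n]\setminus[m]$;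 $\mathbb{GH}(m,n)$ denotes $[n]_{p-1}$ together with this order. $J$ is an unsaturated generalized order ideal if $\bar J$ is an order ideal (down-closed subset) of $\mathbb{H}(m,n)$; it is a saturated generalized order ideal if moreover $J_i=p-1$ whenever $j\in\bar J$ and $i\prec j$. For a generalized order ideal $I$ of either type, $I(\mathbb{GP})\subseteq\mathbb{F}_p^n$ is the set of all generalized order ideals of the same type contained in $I$. -}

module Defs where

open import Data.Bool.Base using (if_then_else_)
open import Data.Fin.Base as Fin using (Fin; toℕ)
open import Data.Fin.Properties as Fin using (all?)
open import Data.Nat.Base as ℕ using (ℕ; NonZero)
open import Data.Nat.DivMod using (_mod_)
import Data.Nat.Properties as ℕ
open import Data.Product using (Σ-syntax; ∃-syntax; _×_; _,_; proj₁)
open import Data.Vec.Base using (Vec; lookup; replicate; foldr′; zipWith)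
open import Data.Vec.Properties using (≡-dec)
open import Level using (0ℓ)
open import Relation.Binary.Core using (Rel)
open import Relation.Binary.Structures using (IsDecStrictPartialOrder)
import Relation.Binary.Construct.StrictToNonStrict as StrictToNonStrict
open import Relation.Binary.PropositionalEquality
  using (_≡_; _≢_; refl; isEquivalence; resp₂)
open import Relation.Nullary.Decidable using (Dec; does; ¬?; _×-dec_; _→-dec_)
open import Relation.Unary using (Pred; Decidable; _∈_)

-- Residues modulo p, represented by 0 , … , p-1; a field when p is prime.
𝔽 : ℕ → Set
𝔽 = Fin

module _ {p : ℕ} .{{_ : NonZero p}} where

  infixl 6 _+_
  infixl 7 _*_ _·_

  0# 1# : 𝔽 p
  0# = 0 mod p
  1# = 1 mod p

  _+_ _*_ : 𝔽 p → 𝔽 p → 𝔽 p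
  a + b = (toℕ a ℕ.+ toℕ b) mod p
  a * b = (toℕ a ℕ.* toℕ b) mod p

  _·_ : ∀ {n} → Vec (𝔽 p) n → Vec (𝔽 p) n → 𝔽 p
  u · x = foldr′ _+_ 0# (zipWith _*_ u x)

  0ⱽ : ∀ {n} → Vec (𝔽 p) n
  0ⱽ = replicate _ 0#

  characteristic : {A : Set} {P : Pred A 0ℓ} → Decidable P → A → 𝔽 p
  characteristic P? x = if does (P? x) then 1# else 0#

-- A code with coordinates indexed by X is a set of words X → 𝔽 p.  Words are
-- compared pointwise.
Word : Set → ℕ → Set
Word X p = X → 𝔽 p

Code : Set → ℕ → Set₁
Code X p = Pred (Word X p) 0ℓ

module _ {X : Set} {p : ℕ} .{{_ : NonZero p}} where

  supp : Word X p → Pred X 0ℓ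
  supp c x = c x ≢ 0#

  NonzeroWord : Word X p → Set
  NonzeroWord c = ∃[ x ] x ∈ supp c

  IsMinimalCodeword : Code X p → Word X p → Set
  IsMinimalCodeword C c =
    c ∈ C × NonzeroWord c ×
    (∀ c′ → c′ ∈ C → (∀ x → x ∈ supp c′ → x ∈ supp c) →
       ∃[ a ] (∀ x → c′ x ≡ a * c x))

  IsMinimalCode : Code X p → Set
  IsMinimalCode C = ∀ c → c ∈ C → NonzeroWord c → IsMinimalCodeword C c

NonzeroVec : (p : ℕ) .{{_ : NonZero p}} → ℕ → Set
NonzeroVec p n = Σ[ x ∈ Vec (𝔽 p) n ] x ≢ 0ⱽ

codeOf : ∀ {p n} .{{_ : NonZero p}} → (Vec (𝔽 p) n → 𝔽 p) → Code (NonzeroVec p n) p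
codeOf {p} {n} f c =
  ∃[ s ] ∃[ u ] (∀ (x : NonzeroVec p n) → c x ≡ s * f (proj₁ x) + u · proj₁ x)

-- The strict order of the hierarchical poset.  Since Fin n counts from 0, the
-- elements of [m] are those i with toℕ i < m.
Hierarchical : (m n : ℕ) → Rel (Fin n) 0ℓ
Hierarchical m n i j = toℕ i ℕ.< m × m ℕ.≤ toℕ j

ℍ : (m n : ℕ) → IsDecStrictPartialOrder _≡_ (Hierarchical m n)
ℍ m n = record
  { isStrictPartialOrder = record
    { isEquivalence = isEquivalence
    ; irrefl        = λ { refl (i<m , m≤i) → ℕ.<⇒≱ i<m m≤i }
    ; trans         = λ { (i<m , _) (_ , m≤k) → i<m , m≤k }
    ; <-resp-≈      = resp₂ (Hierarchical m n)
    }
  ; _≟_  = Fin._≟_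
  ; _<?_ = λ i j → (toℕ i ℕ.<? m) ×-dec (m ℕ.≤? toℕ j)
  }

data IdealType : Set where
  unsaturated saturated : IdealType

-- A sub-multiset of [n]_{p-1}, given by its multiplicity vector, is literally an
-- element of Vec (𝔽 p) n.
module _ {p n : ℕ} .{{_ : NonZero p}} where

  infix 4 _⊆_ _⊆?_

  _⊆_ : Rel (Vec (𝔽 p) n) 0ℓ
  J ⊆ J′ = ∀ i → lookup J i Fin.≤ lookup J′ i

  _⊆?_ : ∀ J J′ → Dec (J ⊆ J′)
  J ⊆? J′ = all? λ i → lookup J i Fin.≤? lookup J′ i

  underlying : Vec (𝔽 p) n → Pred (Fin n) 0ℓ
  underlying J i = lookup J i ≢ 0#

  underlying? : ∀ J → Decidable (underlying J)
  underlying? J i = ¬? (lookup J i Fin.≟ 0#)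

  module _ {_≺_ : Rel (Fin n) 0ℓ} (P : IsDecStrictPartialOrder _≡_ _≺_) where

    open IsDecStrictPartialOrder P using (_≟_; _<?_)
    open StrictToNonStrict _≡_ _≺_ using (decidable) renaming (_≤_ to _≼_)

    IsOrderIdeal : Pred (Fin n) 0ℓ → Set
    IsOrderIdeal S = ∀ i j → j ∈ S → i ≼ j → i ∈ S

    IsOrderIdeal? : ∀ {S} → Decidable S → Dec (IsOrderIdeal S)
    IsOrderIdeal? S? = all? λ i → all? λ j →
      S? j →-dec decidable _≟_ _<?_ i j →-dec S? i

    SaturatedBelow : Pred (Vec (𝔽 p) n) 0ℓ
    SaturatedBelow J =
      ∀ i j → j ∈ underlying J → i ≺ j → toℕ (lookup J i) ≡ p ℕ.∸ 1

    SaturatedBelow? : Decidable SaturatedBelow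
    SaturatedBelow? J = all? λ i → all? λ j →
      underlying? J j →-dec (i <? j) →-dec (toℕ (lookup J i) ℕ.≟ p ℕ.∸ 1)

    IsGeneralizedIdeal : IdealType → Pred (Vec (𝔽 p) n) 0ℓ
    IsGeneralizedIdeal unsaturated J = IsOrderIdeal (underlying J)
    IsGeneralizedIdeal saturated   J = IsOrderIdeal (underlying J) × SaturatedBelow J

    IsGeneralizedIdeal? : ∀ t → Decidable (IsGeneralizedIdeal t)
    IsGeneralizedIdeal? unsaturated J = IsOrderIdeal? (underlying? J)
    IsGeneralizedIdeal? saturated   J =
      IsOrderIdeal? (underlying? J) ×-dec SaturatedBelow? J

    IdealsWithin : IdealType → Vec (𝔽 p) n → Pred (Vec (𝔽 p) n) 0ℓ
    IdealsWithin t I J = IsGeneralizedIdeal t J × J ⊆ I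

    NonzeroIdealsWithin : IdealType → Vec (𝔽 p) n → Pred (Vec (𝔽 p) n) 0ℓ
    NonzeroIdealsWithin t I J = J ∈ IdealsWithin t I × J ≢ 0ⱽ

    NonzeroIdealsWithin? : ∀ t I → Decidable (NonzeroIdealsWithin t I)
    NonzeroIdealsWithin? t I J =
      (IsGeneralizedIdeal? t J ×-dec J ⊆? I) ×-dec ¬? (≡-dec Fin._≟_ J 0ⱽ)

    idealFunction : IdealType → Vec (𝔽 p) n → Vec (𝔽 p) n → 𝔽 p
    idealFunction t I = characteristic (NonzeroIdealsWithin? t I)

{-# OPTIONS --safe #-}
module Submission where

-- In each case there are two words c, c' of the code with supp c' inside supp c
-- and c' not a multiple of c, so that c is not minimal.  Write f for the ideal
-- function and x_i for the i-th coordinate word.  Since I is the full multiset,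
-- f is 1 at every nonzero ideal and 0 elsewhere; and any vector supported on [m]
-- is an ideal of either type, since the elements of [m] are minimal
-- (ideal-in-bottom).
--
-- If m = 1 (¬minimal-bottom), take c = x_1 and c' = f.  A nonzero ideal contains
-- the bottom element 1, so f(x) nonzero forces x_1 nonzero.  At e_1 and 2e_1 the
-- word c' is constantly 1, whereas c takes the values 1 and 2; as p ≥ 3, these
-- are distinct and 2e_1 is nonzero.
--
-- If m = n - 1 and the type is saturated (¬minimal-top), take c = f + x_n and
-- c' = f + x_1.  If c(x) = 0, then x_n is nonzero, since a nonzero x with x_n = 0
-- is an ideal and has c(x) = 1.  Hence f(x) is nonzero too, so x is an ideal, and
-- saturation gives x_1 = p - 1, so that c'(x) = 1 + (p - 1) = 0.  At e_1 and e_2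
-- the word c is constantly 1, whereas c' takes the values 2 and 1; this is where
-- m ≥ 2 enters.

open import Defs
open import Data.Fin.Base as Fin using (Fin; toℕ; fromℕ; zero; suc)
import Data.Fin.Properties as Fin
open import Data.Nat.Base as ℕ
  using (ℕ; NonZero; _∸_; _≤_; _<_; suc; z≤n; s≤s; z<s; s<s)
open import Data.Nat.DivMod using (_mod_; _%_; m<n⇒m%n≡m; n%n≡0)
open import Data.Nat.Divisibility using (_∣_; ∣-refl)
open import Data.Nat.Primality using (Prime; ¬prime[0]; ¬prime[1])
import Data.Nat.Properties as ℕ
open import Data.Product using (_×_; _,_; proj₁)
open import Data.Sum.Base using (inj₁; inj₂)
open import Data.Vec.Base using (Vec; []; _∷_; lookup; _[_]≔_)
open import Data.Vec.Properties
  using (lookup-replicate; lookup∘update; lookup∘update′)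
open import Data.Vec.Relation.Binary.Pointwise.Extensional
  using (ext; Pointwise-≡⇒≡)
open import Function.Base using (_$_)
open import Level using (0ℓ)
open import Relation.Binary.PropositionalEquality
  using (_≡_; _≢_; refl; sym; trans; cong; cong₂; subst; module ≡-Reasoning)
open import Relation.Nullary using (¬_; yes; no; contradiction)
open import Relation.Nullary.Decidable using (dec-true; dec-false; decidable-stable)
open import Relation.Unary using (Pred; Decidable)

-- Vectors over the residues modulo p

module _ {p : ℕ} .{{_ : NonZero p}} where

  vec-≡0 : ∀ {n} (x : Vec (𝔽 p) n) → (∀ i → lookup x i ≡ 0#) → x ≡ 0ⱽ
  vec-≡0 x x≡0 = Pointwise-≡⇒≡
    (ext λ i → trans (x≡0 i) (sym (lookup-replicate i 0#)))

  -- The multiple a e_i of the i-th basis vector.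
  single : ∀ {n} → Fin n → 𝔽 p → Vec (𝔽 p) n
  single i a = 0ⱽ [ i ]≔ a

  lookup-single : ∀ {n} (i : Fin n) a → lookup (single i a) i ≡ a
  lookup-single i a = lookup∘update i 0ⱽ a

  lookup-single′ : ∀ {n} {i j : Fin n} → j ≢ i → ∀ a → lookup (single i a) j ≡ 0#
  lookup-single′ {i = i} {j} j≢i a =
    trans (lookup∘update′ j≢i 0ⱽ a) (lookup-replicate j 0#)

  single≢0 : ∀ {n} (i : Fin n) {a} → a ≢ 0# → single i a ≢ 0ⱽ
  single≢0 i {a} a≢0 eq = a≢0 $ begin
    a                      ≡⟨ lookup-single i a ⟨
    lookup (single i a) i  ≡⟨ cong (λ v → lookup v i) eq ⟩
    lookup 0ⱽ i            ≡⟨ lookup-replicate i 0# ⟩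
    0#                     ∎
    where open ≡-Reasoning

  characteristic-true : ∀ {A : Set} {P : Pred A 0ℓ} (P? : Decidable P) {x} →
                        P x → characteristic {p} P? x ≡ 1#
  characteristic-true P? {x} Px rewrite dec-true (P? x) Px = refl

  characteristic-false : ∀ {A : Set} {P : Pred A 0ℓ} (P? : Decidable P) {x} →
                         ¬ P x → characteristic {p} P? x ≡ 0#
  characteristic-false P? {x} ¬Px rewrite dec-false (P? x) ¬Px = refl

-- Ideals of the hierarchical poset

module _ {p n : ℕ} .{{_ : NonZero p}} where

  ⊆-full : (I : Vec (𝔽 p) n) → (∀ i → toℕ (lookup I i) ≡ p ∸ 1) → ∀ J → J ⊆ I
  ⊆-full I full J i =
    subst (toℕ (lookup J i) ≤_) (sym (full i)) (ℕ.<⇒≤pred (Fin.toℕ<n (lookup J i)))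

module _ {p : ℕ} .{{_ : NonZero p}} {m n : ℕ} where

  ideal-in-bottom : ∀ t (J : Vec (𝔽 p) n) → (∀ j → underlying J j → toℕ j < m) →
                    IsGeneralizedIdeal (ℍ m n) t J
  ideal-in-bottom t J J⊆[m] = by-type t
    where
    down-closed : IsOrderIdeal (ℍ m n) (underlying J)
    down-closed i j Jj (inj₁ (_ , m≤j)) = contradiction m≤j (ℕ.<⇒≱ (J⊆[m] j Jj))
    down-closed i j Jj (inj₂ refl)      = Jj

    by-type : ∀ t → IsGeneralizedIdeal (ℍ m n) t J
    by-type unsaturated = down-closed
    by-type saturated   =
      down-closed , λ i j Jj (_ , m≤j) → contradiction m≤j (ℕ.<⇒≱ (J⊆[m] j Jj))

  order-ideal : ∀ t (J : Vec (𝔽 p) n) → IsGeneralizedIdeal (ℍ m n) t J →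
                IsOrderIdeal (ℍ m n) (underlying J)
  order-ideal unsaturated J ideal       = ideal
  order-ideal saturated   J (ideal , _) = ideal

-- Arithmetic modulo p, and the non-minimality criterion

-- The modulus p ≥ 3 is written 3 + q, so that 0#, 1# and 2# compute to the
-- first three elements of Fin (3 + q).
module _ {q : ℕ} where

  private
    p = 3 ℕ.+ q

  2# : 𝔽 p
  2# = suc 1#

  toℕ-mod : ∀ (a : 𝔽 p) → toℕ a mod p ≡ a
  toℕ-mod a = Fin.toℕ-injective
    (trans (Fin.toℕ-fromℕ< _) (m<n⇒m%n≡m (Fin.toℕ<n a)))

  +-identityˡ : ∀ (a : 𝔽 p) → 0# + a ≡ a
  +-identityˡ = toℕ-mod

  +-identityʳ : ∀ (a : 𝔽 p) → a + 0# ≡ a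
  +-identityʳ a = trans (cong (_mod p) (ℕ.+-identityʳ (toℕ a))) (toℕ-mod a)

  *-identityˡ : ∀ (a : 𝔽 p) → 1# * a ≡ a
  *-identityˡ a = trans (cong (_mod p) (ℕ.*-identityˡ (toℕ a))) (toℕ-mod a)

  *-identityʳ : ∀ (a : 𝔽 p) → a * 1# ≡ a
  *-identityʳ a = trans (cong (_mod p) (ℕ.*-identityʳ (toℕ a))) (toℕ-mod a)

  1+[p-1]≡0 : ∀ (a : 𝔽 p) → toℕ a ≡ p ∸ 1 → 1# + a ≡ 0#
  1+[p-1]≡0 a a≡p-1 = Fin.toℕ-injective $ begin
    toℕ (1# + a)       ≡⟨ Fin.toℕ-fromℕ< _ ⟩
    (1 ℕ.+ toℕ a) % p  ≡⟨ cong (λ k → (1 ℕ.+ k) % p) a≡p-1 ⟩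
    p % p              ≡⟨ n%n≡0 p ⟩
    0                  ∎
    where open ≡-Reasoning

  0ⱽ·x≡0 : ∀ {n} (x : Vec (𝔽 p) n) → 0ⱽ · x ≡ 0#
  0ⱽ·x≡0 []       = refl
  0ⱽ·x≡0 (a ∷ x) = trans (+-identityˡ (0ⱽ · x)) (0ⱽ·x≡0 x)

  -- The i-th standard basis vector e_i, whose linear form is the i-th coordinate.
  basis : ∀ {n} → Fin n → Vec (𝔽 p) n
  basis i = single i 1#

  basis·x≡lookup : ∀ {n} (i : Fin n) (x : Vec (𝔽 p) n) → basis i · x ≡ lookup x i
  basis·x≡lookup zero (a ∷ x) = begin
    1# * a + 0ⱽ · x  ≡⟨ cong₂ _+_ (*-identityˡ a) (0ⱽ·x≡0 x) ⟩
    a + 0#           ≡⟨ +-identityʳ a ⟩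
    a                ∎
    where open ≡-Reasoning
  basis·x≡lookup (suc i) (a ∷ x) =
    trans (+-identityˡ (basis i · x)) (basis·x≡lookup i x)

  -- If c(x) = 1, then the only possible multiple of c equal to c' is c'(x) c, so
  -- a single further point y refutes proportionality.
  ¬minimal : ∀ {X : Set} {C : Code X p} (c c′ : Word X p) →
             C c → C c′ → (∀ x → supp c′ x → supp c x) →
             ∀ x y → c x ≡ 1# → c′ y ≢ c′ x * c y → ¬ IsMinimalCode C
  ¬minimal c c′ c∈C c′∈C supp⊆ x y cx≡1 c′y≢ minimal
    with minimal c c∈C (x , λ cx≡0 → contradiction (trans (sym cx≡1) cx≡0) λ ())
  ... | _ , _ , multiple with multiple c′ c′∈C supp⊆
  ... | a , c′≡ac = c′y≢ (trans (c′≡ac y) (cong (_* c y) (sym c′x≡a)))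
    where
    c′x≡a : c′ x ≡ a
    c′x≡a = trans (c′≡ac x) (trans (cong (a *_) cx≡1) (*-identityʳ a))

  module _ {n : ℕ} (f : Vec (𝔽 p) n → 𝔽 p) where

    -- A word is indexed by pairs of a vector x and a proof that x is nonzero.
    f∈code : codeOf f (λ x → f (proj₁ x))
    f∈code = 1# , 0ⱽ , λ (x , _) → sym $
      trans (cong₂ _+_ (*-identityˡ (f x)) (0ⱽ·x≡0 x)) (+-identityʳ (f x))

    coordinate∈code : ∀ i → codeOf f (λ x → lookup (proj₁ x) i)
    coordinate∈code i = 0# , basis i , λ (x , _) → sym $
      trans (+-identityˡ (basis i · x)) (basis·x≡lookup i x)

    f+coordinate∈code : ∀ i → codeOf f (λ x → f (proj₁ x) + lookup (proj₁ x) i)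
    f+coordinate∈code i = 1# , basis i , λ (x , _) → sym $
      cong₂ _+_ (*-identityˡ (f x)) (basis·x≡lookup i x)

  -- The ideal function f of a multiset I in which every element has the maximal
  -- multiplicity p - 1: it is 1 at nonzero ideals and 0 elsewhere.

  module _ (m : ℕ) {n : ℕ} (t : IdealType) (I : Vec (𝔽 p) n)
           (full : ∀ i → toℕ (lookup I i) ≡ p ∸ 1) where

    private
      f : Vec (𝔽 p) n → 𝔽 p
      f = idealFunction (ℍ m n) t I

      f? = NonzeroIdealsWithin? (ℍ m n) t I

    f-ideal : ∀ J → IsGeneralizedIdeal (ℍ m n) t J → J ≢ 0ⱽ → f J ≡ 1#
    f-ideal J ideal J≢0 = characteristic-true f? ((ideal , ⊆-full I full J) , J≢0)

    f-nonideal : ∀ J → ¬ IsGeneralizedIdeal (ℍ m n) t J → f J ≡ 0#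
    f-nonideal J ¬ideal = characteristic-false f? λ ((ideal , _) , _) → ¬ideal ideal

    f-single : ∀ i a → toℕ i < m → a ≢ 0# → f (single i a) ≡ 1#
    f-single i a i<m a≢0 = f-ideal (single i a)
      (ideal-in-bottom t (single i a) support) (single≢0 i a≢0)
      where
      support : ∀ j → underlying (single i a) j → toℕ j < m
      support j a_j≢0 with j Fin.≟ i
      ... | yes refl = i<m
      ... | no  j≢i  = contradiction (lookup-single′ j≢i a) a_j≢0

-- A poset with a bottom element: m = 1

module _ {q k : ℕ} where

  private
    p = 3 ℕ.+ q
    n = suc k

  -- The element 1 of the poset is the index zero; it lies below every other one,
  -- so an ideal omitting it is empty.
  ideal-bottom : ∀ t {x : Vec (𝔽 p) n} → IsGeneralizedIdeal (ℍ 1 n) t x →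
                 x ≢ 0ⱽ → lookup x zero ≢ 0#
  ideal-bottom t {x} ideal x≢0 x₁≡0 = x≢0 (vec-≡0 x x≡0)
    where
    x≡0 : ∀ i → lookup x i ≡ 0#
    x≡0 zero    = x₁≡0
    x≡0 (suc j) = decidable-stable (lookup x (suc j) Fin.≟ 0#) λ x_j≢0 →
      order-ideal t x ideal zero (suc j) x_j≢0 (inj₁ (z<s , s≤s z≤n)) x₁≡0

  ¬minimal-bottom : ∀ t (I : Vec (𝔽 p) n) → (∀ i → toℕ (lookup I i) ≡ p ∸ 1) →
                    ¬ IsMinimalCode (codeOf (idealFunction (ℍ 1 n) t I))
  ¬minimal-bottom t I full =
    ¬minimal x₁ (λ x → f (proj₁ x)) (coordinate∈code f zero) (f∈code f)
      supp⊆ e₁ 2e₁ refl values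
    where
    f : Vec (𝔽 p) n → 𝔽 p
    f = idealFunction (ℍ 1 n) t I

    x₁ : Word (NonzeroVec p n) p
    x₁ x = lookup (proj₁ x) zero

    e₁ 2e₁ : NonzeroVec p n
    e₁  = basis zero     , single≢0 zero λ ()
    2e₁ = single zero 2# , single≢0 zero λ ()

    supp⊆ : ∀ ((x , _) : NonzeroVec p n) → f x ≢ 0# → lookup x zero ≢ 0#
    supp⊆ (x , x≢0) fx≢0 x₁≡0 = fx≢0 $ f-nonideal 1 t I full x λ ideal →
      ideal-bottom t ideal x≢0 x₁≡0

    values : f (proj₁ 2e₁) ≢ f (proj₁ e₁) * 2#
    values eq = contradiction 1≡2 λ ()
      where
      open ≡-Reasoning
      1≡2 : 1# ≡ 2# {q}
      1≡2 = begin
        1#                   ≡⟨ f-single 1 t I full zero 2# z<s (λ ()) ⟨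
        f (proj₁ 2e₁)        ≡⟨ eq ⟩
        f (proj₁ e₁) * 2#    ≡⟨ cong (_* 2#) (f-single 1 t I full zero 1# z<s λ ()) ⟩
        1# * 2#              ≡⟨ *-identityˡ 2# ⟩
        2#                   ∎

-- A poset with a top element: m = n - 1, saturated type

module _ {q k : ℕ} where

  private
    p = 3 ℕ.+ q
    m = 2 ℕ.+ k
    n = suc m

  -- The element n of the poset, the only one outside [m].
  top : Fin n
  top = fromℕ m

  below-top : ∀ (j : Fin n) → j ≢ top → toℕ j < m
  below-top j j≢top = ℕ.≤∧≢⇒< (ℕ.<⇒≤pred (Fin.toℕ<n j)) λ j≡m →
    j≢top (Fin.toℕ-injective (trans j≡m (sym (Fin.toℕ-fromℕ m))))

  ideal-without-top : ∀ t (x : Vec (𝔽 p) n) → lookup x top ≡ 0# →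
                      IsGeneralizedIdeal (ℍ m n) t x
  ideal-without-top t x xₙ≡0 = ideal-in-bottom t x λ j x_j≢0 →
    below-top j λ { refl → x_j≢0 xₙ≡0 }

  saturated-below-top : ∀ (x : Vec (𝔽 p) n) → IsGeneralizedIdeal (ℍ m n) saturated x →
                        lookup x top ≢ 0# → toℕ (lookup x zero) ≡ p ∸ 1
  saturated-below-top x (_ , sat) xₙ≢0 =
    sat zero top xₙ≢0 (z<s , ℕ.≤-reflexive (sym (Fin.toℕ-fromℕ m)))

  ¬minimal-top : ∀ (I : Vec (𝔽 p) n) → (∀ i → toℕ (lookup I i) ≡ p ∸ 1) →
                 ¬ IsMinimalCode (codeOf (idealFunction (ℍ m n) saturated I))
  ¬minimal-top I full =
    ¬minimal c c′ (f+coordinate∈code f top) (f+coordinate∈code f zero)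
      (λ x c′x≢0 cx≡0 → c′x≢0 (zeros x cx≡0)) e₂ e₁
      (f+0≡1 (suc zero) (s<s z<s) top λ ()) values
    where
    open ≡-Reasoning

    f : Vec (𝔽 p) n → 𝔽 p
    f = idealFunction (ℍ m n) saturated I

    c c′ : Word (NonzeroVec p n) p
    c  (x , _) = f x + lookup x top
    c′ (x , _) = f x + lookup x zero

    e₁ e₂ : NonzeroVec p n
    e₁ = basis zero       , single≢0 zero λ ()
    e₂ = basis (suc zero) , single≢0 (suc zero) λ ()

    -- The contrapositive of the inclusion supp c' ⊆ supp c.
    zeros : ∀ x → c x ≡ 0# → c′ x ≡ 0#
    zeros (x , x≢0) cx≡0 = begin
      f x + lookup x zero  ≡⟨ cong (_+ lookup x zero)
                                (f-ideal m saturated I full x ideal x≢0) ⟩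
      1# + lookup x zero   ≡⟨ 1+[p-1]≡0 (lookup x zero) (saturated-below-top x ideal xₙ≢0) ⟩
      0#                   ∎
      where
      xₙ≢0 : lookup x top ≢ 0#
      xₙ≢0 xₙ≡0 = contradiction 1≡0 λ ()
        where
        1≡0 : 1# ≡ 0# {p}
        1≡0 = begin
          1#                  ≡⟨ f-ideal m saturated I full x
                                   (ideal-without-top saturated x xₙ≡0) x≢0 ⟨
          f x                 ≡⟨ +-identityʳ (f x) ⟨
          f x + 0#            ≡⟨ cong (f x +_) xₙ≡0 ⟨
          f x + lookup x top  ≡⟨ cx≡0 ⟩
          0#                  ∎

      ideal : IsGeneralizedIdeal (ℍ m n) saturated x
      ideal = decidable-stable (IsGeneralizedIdeal? (ℍ m n) saturated x) λ ¬ideal →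
        xₙ≢0 $ begin
        lookup x top        ≡⟨ +-identityˡ (lookup x top) ⟨
        0# + lookup x top   ≡⟨ cong (_+ lookup x top)
                                 (f-nonideal m saturated I full x ¬ideal) ⟨
        f x + lookup x top  ≡⟨ cx≡0 ⟩
        0#                  ∎

    -- The word f + x_j has the value 1 at e_i, for i in [m] and j distinct from i.
    f+0≡1 : ∀ i → toℕ i < m → ∀ j → j ≢ i →
            f (basis i) + lookup (basis i) j ≡ 1#
    f+0≡1 i i<m j j≢i =
      trans (cong₂ _+_ (f-single m saturated I full i 1# i<m λ ()) (lookup-single′ j≢i 1#))
            (+-identityʳ 1#)

    values : c′ e₁ ≢ c′ e₂ * c e₁
    values eq = contradiction 2≡1 λ ()
      where
      2≡1 : 2# {q} ≡ 1#
      2≡1 = begin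
        1# + 1#        ≡⟨ cong (_+ 1#) (f-single m saturated I full zero 1# z<s λ ()) ⟨
        c′ e₁          ≡⟨ eq ⟩
        c′ e₂ * c e₁   ≡⟨ cong₂ _*_ (f+0≡1 (suc zero) (s<s z<s) zero λ ())
                                   (f+0≡1 zero z<s top λ ()) ⟩
        1# * 1#        ≡⟨ *-identityˡ 1# ⟩
        1#             ∎

proposition5p3 : ∀ (p : ℕ) .{{_ : NonZero p}} → Prime p → ¬ (2 ∣ p) →
    ∀ (m n : ℕ) → 1 ≤ m → m ≤ n →
    ∀ (t : IdealType) (I : Vec (𝔽 p) n) →
    IsGeneralizedIdeal (ℍ m n) t I →
    (∀ i → toℕ (lookup I i) ≡ p ∸ 1) →
    (m ≡ 1 → ¬ IsMinimalCode (codeOf (idealFunction (ℍ m n) t I)))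
    × (m ≡ n ∸ 1 → 2 ≤ n ∸ 1 → t ≡ saturated →
    ¬ IsMinimalCode (codeOf (idealFunction (ℍ m n) t I)))
proposition5p3 0 prime-p _ = contradiction prime-p ¬prime[0]
proposition5p3 1 prime-p _ = contradiction prime-p ¬prime[1]
proposition5p3 2 _ 2∤2     = contradiction ∣-refl 2∤2
proposition5p3 (suc (suc (suc q))) _ _ m n _ m≤n t I _ full =
  bottom-case m≤n I full , top-case I full
  where
  p = 3 ℕ.+ q

  bottom-case : ∀ {m n} → m ≤ n → (I : Vec (𝔽 p) n) →
                (∀ i → toℕ (lookup I i) ≡ p ∸ 1) → m ≡ 1 →
                ¬ IsMinimalCode (codeOf (idealFunction (ℍ m n) t I))
  bottom-case (s≤s _) I full refl = ¬minimal-bottom t I full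

  top-case : ∀ {m n t} (I : Vec (𝔽 p) n) →
             (∀ i → toℕ (lookup I i) ≡ p ∸ 1) →
             m ≡ n ∸ 1 → 2 ≤ n ∸ 1 → t ≡ saturated →
             ¬ IsMinimalCode (codeOf (idealFunction (ℍ m n) t I))
  top-case {n = suc _} I full refl (s≤s (s≤s _)) refl = ¬minimal-top I full
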